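{- Let $C_m$ and $C_n$ be chains with $m\ge2$ and $n\ge2$ elements, respectively. Then the product poset $C_m\times C_n$ has a $1/3$-balanced pair.
   Context: $C_k$ denotes the totally ordered set with $k$ elements; $C_m\times C_n$ is ordered componentwise. For distinct $x,y$ in a finite poset $P$, $\mathbb{P}(x\prec y)$ is the proportion of linear extensions of $P$ (total orders compatible with the partial order) in which $x$ comes before $y$. A pair $(x,y)$ is $1/3$-balanced if $1/3\le\mathbb{P}(x\prec y)\le2/3$. -}

module Defs where

open import Data.Nat using (ℕ; _*_; _≤_)
open import Data.Fin using (Fin)
import Data.Fin as F
import Data.Fin.Properties as FP
open import Data.Product using (_×_; _,_; proj₁; proj₂)
open import Data.Product.Properties using (≡-dec)
open import Data.Bool using (Bool; true; false; _∧_; if_then_else_)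
open import Data.List using (List; []; _∷_; map; concatMap; filterᵇ; length; allFin; cartesianProduct)
open import Data.Bool.ListAction using (all; any)
open import Relation.Nullary.Decidable using (⌊_⌋)

Elt : ℕ → ℕ → Set
Elt m n = Fin m × Fin n

_≤P_ : ∀ {m n} → Elt m n → Elt m n → Set
(a , b) ≤P (c , d) = (a F.≤ c) × (b F.≤ d)

_==_ : ∀ {m n} → Elt m n → Elt m n → Bool
x == y = ⌊ ≡-dec FP._≟_ FP._≟_ x y ⌋

_≤Pᵇ_ : ∀ {m n} → Elt m n → Elt m n → Bool
(a , b) ≤Pᵇ (c , d) = ⌊ a FP.≤? c ⌋ ∧ ⌊ b FP.≤? d ⌋

_<Pᵇ_ : ∀ {m n} → Elt m n → Elt m n → Bool
x <Pᵇ y = (x ≤Pᵇ y) ∧ (if x == y then false else true)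

elems : (m n : ℕ) → List (Elt m n)
elems m n = cartesianProduct (allFin m) (allFin n)

insertions : ∀ {A : Set} → A → List A → List (List A)
insertions x [] = (x ∷ []) ∷ []
insertions x (y ∷ ys) = (x ∷ y ∷ ys) ∷ map (y ∷_) (insertions x ys)

perms : ∀ {A : Set} → List A → List (List A)
perms [] = [] ∷ []
perms (x ∷ xs) = concatMap (insertions x) (perms xs)

before : ∀ {m n} → Elt m n → Elt m n → List (Elt m n) → Bool
before x y [] = false
before x y (z ∷ zs) =
  if z == x then any (y ==_) zs
  else (if z == y then false else before x y zs)

compatible : ∀ {m n} → List (Elt m n) → Bool
compatible {m} {n} L =
  all (λ x → all (λ y → if x <Pᵇ y then before x y L else true) (elems m n)) (elems m n)

linExts : (m n : ℕ) → List (List (Elt m n))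
linExts m n = filterᵇ compatible (perms (elems m n))

numLinExts : (m n : ℕ) → ℕ
numLinExts m n = length (linExts m n)

numBefore : ∀ {m n} → Elt m n → Elt m n → ℕ
numBefore {m} {n} x y = length (filterᵇ (before x y) (linExts m n))

-- (x , y) is 1/3-balanced:  1/3 ≤ numBefore / numLinExts ≤ 2/3  (cleared denominators)
Balanced : ∀ {m n} → Elt m n → Elt m n → Set
Balanced {m} {n} x y =
  (numLinExts m n ≤ 3 * numBefore x y) × (3 * numBefore x y ≤ 2 * numLinExts m n)

{-# OPTIONS --safe #-}
-- Let x be an atom such that the elements not above x form a chain c₀ < c₁ < … < c₍ₖ₋₁₎ with c₀ the
-- minimum of the poset.  A linear extension starts with c₀ … c₍ₚ₋₁₎ x for some p ≥ 1, and exchanging x with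
-- its predecessor shows that the number of linear extensions with x in position p decreases with p ≥ 1.
-- Hence, if P(x ≺ c₁) ≤ 1/2, the sequence P(x ≺ cᵢ) starts at or below 1/2 and, as long as it is below 1/3,
-- grows in steps of at most P(x ≺ c₁), so it meets [1/3, 2/3].  In a product of two chains this applies
-- to x = (1,0), with c the first row, and to x = (0,1), with c the first column; the two values of
-- P(x ≺ c₁) sum to 1, so one of them is at most 1/2.
module Submission where

open import Defs
open import Data.Nat using (ℕ; _≤_)
open import Data.Product using (Σ; _×_)
open import Relation.Binary.PropositionalEquality using (_≢_)

open import Data.Bool using (true; false; T; T?; if_then_else_)
open import Data.Bool.Properties using (T-∧)
open import Data.Empty using (⊥; ⊥-elim)
open import Data.Fin using (Fin; zero; suc; toℕ; fromℕ<)
import Data.Fin as F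
import Data.Fin.Properties as FP
open import Data.List using (List; []; _∷_; _++_; map; concatMap; filter; length; take)
open import Data.List.Properties using (∷-injectiveʳ; filter-all; length-map)
open import Data.List.Membership.Propositional using (_∈_; _∉_; find; lose)
import Data.List.Membership.DecPropositional as DecMembership
open import Data.List.Membership.Propositional.Properties using (∈-∃++; ∈-allFin; ∈-cartesianProduct⁺; ∈-concatMap⁺; ∈-concatMap⁻; ∈-filter⁺; ∈-filter⁻; ∈-map⁺; ∈-map⁻)
open import Data.List.Relation.Binary.Disjoint.Propositional using (Disjoint)
open import Data.List.Relation.Binary.Permutation.Propositional using (_↭_; refl; prep; swap; ↭-sym; ↭-trans; ↭⇒↭ₛ)
open import Data.List.Relation.Binary.Permutation.Propositional.Properties using (∈-resp-↭; ↭-length; shift; drop-mid; ↭-empty-inv)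
import Data.List.Relation.Binary.Permutation.Setoid.Properties as PermutationSetoid
open import Data.List.Relation.Unary.All as All using ([]; _∷_)
import Data.List.Relation.Unary.All.Properties as AllP
open import Data.List.Relation.Unary.AllPairs using ([]; _∷_)
open import Data.List.Relation.Unary.Any using (here; there)
import Data.List.Relation.Unary.Any.Properties as AnyP
open import Data.List.Relation.Unary.Unique.Propositional using (Unique)
import Data.List.Relation.Unary.Unique.Propositional.Properties as UniqueP
open import Data.Nat using (zero; suc; _+_; _*_; _<_; z≤n; s≤s; _≤?_)
open import Data.Nat.Properties
open import Data.Product using (_,_; ∃; proj₁; proj₂)
open import Data.Product.Properties using (≡-dec)
open import Data.Sum using (_⊎_; inj₁; inj₂; [_,_]′)
open import Function using (_∘_; case_of_)
open import Function.Bundles using (Equivalence)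
open import Function.Definitions using (Injective)
open import Relation.Binary.Definitions using (DecidableEquality)
open import Relation.Binary.PropositionalEquality using (_≡_; refl; sym; trans; cong; subst; setoid)
open import Relation.Nullary using (¬_; yes; no; contradiction)
open import Relation.Nullary.Decidable using (toWitness; fromWitness)
open import Relation.Unary using (Decidable)

private variable
  A : Set

-- Counting

count : {P : A → Set} → Decidable P → List A → ℕ
count P? xs = length (filter P? xs)

module _ {P Q R : A → Set} (P? : Decidable P) (Q? : Decidable Q) (R? : Decidable R) where

  count-≤-+ : ∀ xs → (∀ {x} → x ∈ xs → P x → Q x ⊎ R x) → count P? xs ≤ count Q? xs + count R? xs
  count-≤-+ []       h = z≤n
  count-≤-+ (x ∷ xs) h with ih ← count-≤-+ xs (h ∘ there) | P? x | Q? x | R? x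
  ... | yes _ | yes _ | yes _ = s≤s (≤-trans ih (+-monoʳ-≤ _ (n≤1+n _)))
  ... | yes _ | yes _ | no  _ = s≤s ih
  ... | yes _ | no  _ | yes _ = ≤-trans (s≤s ih) (≤-reflexive (sym (+-suc _ _)))
  ... | yes p | no ¬q | no ¬r = ⊥-elim ([ ¬q , ¬r ]′ (h (here refl) p))
  ... | no _  | yes _ | yes _ = m≤n⇒m≤1+n (≤-trans ih (+-monoʳ-≤ _ (n≤1+n _)))
  ... | no _  | yes _ | no  _ = m≤n⇒m≤1+n ih
  ... | no _  | no  _ | yes _ = ≤-trans ih (+-monoʳ-≤ _ (n≤1+n _))
  ... | no _  | no  _ | no  _ = ih

module _ {P Q : A → Set} (P? : Decidable P) (Q? : Decidable Q) where

  count-mono : ∀ xs → (∀ {x} → x ∈ xs → P x → Q x) → count P? xs ≤ count Q? xs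
  count-mono []       h = z≤n
  count-mono (x ∷ xs) h with ih ← count-mono xs (h ∘ there) | P? x | Q? x
  ... | yes _ | yes _ = s≤s ih
  ... | yes p | no ¬q = contradiction (h (here refl) p) ¬q
  ... | no  _ | yes _ = m≤n⇒m≤1+n ih
  ... | no  _ | no  _ = ih

  count-disjoint : ∀ xs → (∀ {x} → P x → ¬ Q x) → count P? xs + count Q? xs ≤ length xs
  count-disjoint []       h = z≤n
  count-disjoint (x ∷ xs) h with ih ← count-disjoint xs h | P? x | Q? x
  ... | yes p | yes q = contradiction q (h p)
  ... | yes _ | no  _ = s≤s ih
  ... | no  _ | yes _ = ≤-trans (≤-reflexive (+-suc _ _)) (s≤s ih)
  ... | no  _ | no  _ = m≤n⇒m≤1+n ih

-- Induction on `xs`: one occurrence of the head is cut out of `ys`. The later entries of `xs`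
-- differ from that head, so they all survive in `as ++ bs`.
Unique-⊆⇒length-≤ : {xs ys : List A} → Unique xs → (∀ {x} → x ∈ xs → x ∈ ys) → length xs ≤ length ys
Unique-⊆⇒length-≤ {xs = []}     _        _  = z≤n
Unique-⊆⇒length-≤ {xs = x ∷ xs} (x∉ ∷ u) xs⊆ys with ∈-∃++ (xs⊆ys (here refl))
... | as , bs , refl = ≤-trans (s≤s (Unique-⊆⇒length-≤ u xs⊆as++bs)) (≤-reflexive (sym (↭-length (shift x as bs))))
  where
  xs⊆as++bs : ∀ {z} → z ∈ xs → z ∈ as ++ bs
  xs⊆as++bs z∈xs with ∈-resp-↭ (shift x as bs) (xs⊆ys (there z∈xs))
  ... | here refl = contradiction refl (All.lookup x∉ z∈xs)
  ... | there z∈  = z∈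

-- The image under `f` of the entries satisfying `P` is again free of repetitions and lies among the
-- entries satisfying `Q`. This is why the list of linear extensions must be shown to be `Unique`.
count-injection : {P Q : A → Set} (P? : Decidable P) (Q? : Decidable Q) {xs : List A} {f : A → A} →
  Unique xs → Injective _≡_ _≡_ f → (∀ {x} → x ∈ xs → P x → f x ∈ xs × Q (f x)) →
  count P? xs ≤ count Q? xs
count-injection P? Q? {xs} {f} u inj h =
  subst (_≤ count Q? xs) (length-map f (filter P? xs))
    (Unique-⊆⇒length-≤ (UniqueP.map⁺ inj (UniqueP.filter⁺ P? u)) sub)
  where
  sub : ∀ {y} → y ∈ map f (filter P? xs) → y ∈ filter Q? xs
  sub y∈ with ∈-map⁻ f y∈
  ... | x , x∈ , refl with ∈-filter⁻ P? x∈
  ...   | x∈xs , px with h x∈xs px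
  ...     | fx∈xs , qfx = ∈-filter⁺ Q? fx∈xs qfx

-- Enumeration of permutations

Unique-resp-↭ : {xs ys : List A} → xs ↭ ys → Unique xs → Unique ys
Unique-resp-↭ p = PermutationSetoid.Unique-resp-↭ (setoid _) (↭⇒↭ₛ p)

∈-insertions⁻ : {x : A} (ys : List A) {L : List A} → L ∈ insertions x ys → L ↭ x ∷ ys
∈-insertions⁻ []       (here refl) = refl
∈-insertions⁻ (y ∷ ys) (here refl) = refl
∈-insertions⁻ (y ∷ ys) (there L∈) with ∈-map⁻ (y ∷_) L∈
... | L′ , L′∈ , refl = ↭-trans (prep y (∈-insertions⁻ ys L′∈)) (swap y _ refl)

∈-insertions⁺ : (x : A) (as bs : List A) → as ++ x ∷ bs ∈ insertions x (as ++ bs)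
∈-insertions⁺ x []       []      = here refl
∈-insertions⁺ x []       (_ ∷ _) = here refl
∈-insertions⁺ x (a ∷ as) bs      = there (∈-map⁺ (a ∷_) (∈-insertions⁺ x as bs))

-- Since `x` occurs in neither list, deleting it from `L` recovers both. Hence the blocks that
-- `perms` concatenates are pairwise disjoint.
insertions-injective : {x : A} (ys zs : List A) {L : List A} → x ∉ ys → x ∉ zs →
  L ∈ insertions x ys → L ∈ insertions x zs → ys ≡ zs
insertions-injective []       []       _  _  _           _           = refl
insertions-injective []       (z ∷ zs) _  x∉ (here refl) (there L∈) with ∈-map⁻ (z ∷_) L∈
... | _ , _ , refl = contradiction (here refl) x∉
insertions-injective (y ∷ ys) []       x∉ _  (there L∈) (here refl) with ∈-map⁻ (y ∷_) L∈
... | _ , _ , refl = contradiction (here refl) x∉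
insertions-injective (y ∷ ys) (z ∷ zs) _  _  (here refl) (here refl) = refl
insertions-injective (y ∷ ys) (z ∷ zs) _  x∉ (here refl) (there L∈) with ∈-map⁻ (z ∷_) L∈
... | _ , _ , refl = contradiction (here refl) x∉
insertions-injective (y ∷ ys) (z ∷ zs) x∉ _  (there L∈) (here refl) with ∈-map⁻ (y ∷_) L∈
... | _ , _ , refl = contradiction (here refl) x∉
insertions-injective (y ∷ ys) (z ∷ zs) x∉ x∉′ (there L∈) (there L∈′)
  with ∈-map⁻ (y ∷_) L∈ | ∈-map⁻ (z ∷_) L∈′
... | _ , K∈ , refl | _ , K∈′ , refl =
  cong (y ∷_) (insertions-injective ys zs (x∉ ∘ there) (x∉′ ∘ there) K∈ K∈′)

insertions-unique : (x : A) (ys : List A) → x ∉ ys → Unique (insertions x ys)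
insertions-unique x []       _  = [] ∷ []
insertions-unique x (y ∷ ys) x∉ =
  All.tabulate head≢ ∷ UniqueP.map⁺ ∷-injectiveʳ (insertions-unique x ys (x∉ ∘ there))
  where
  head≢ : ∀ {L} → L ∈ map (y ∷_) (insertions x ys) → x ∷ y ∷ ys ≢ L
  head≢ L∈ refl with ∈-map⁻ (y ∷_) L∈
  ... | _ , _ , refl = x∉ (here refl)

concatMap-insertions-unique : (x : A) (yss : List (List A)) → Unique yss → (∀ {ys} → ys ∈ yss → x ∉ ys) →
  Unique (concatMap (insertions x) yss)
concatMap-insertions-unique x []         _        _ = []
concatMap-insertions-unique x (ys ∷ yss) (ys∉ ∷ u) x∉ =
  UniqueP.++⁺ (insertions-unique x ys (x∉ (here refl)))
    (concatMap-insertions-unique x yss u (x∉ ∘ there)) disjoint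
  where
  disjoint : Disjoint (insertions x ys) (concatMap (insertions x) yss)
  disjoint (L∈ , L∈′) with find (∈-concatMap⁻ (insertions x) {xs = yss} L∈′)
  ... | zs , zs∈ , L∈″ =
    All.lookup ys∉ zs∈ (insertions-injective ys zs (x∉ (here refl)) (x∉ (there zs∈)) L∈ L∈″)

∈-perms⁻ : (xs : List A) {L : List A} → L ∈ perms xs → L ↭ xs
∈-perms⁻ []       (here refl) = refl
∈-perms⁻ (x ∷ xs) L∈ with find (∈-concatMap⁻ (insertions x) {xs = perms xs} L∈)
... | ys , ys∈ , L∈′ = ↭-trans (∈-insertions⁻ ys L∈′) (prep x (∈-perms⁻ xs ys∈))

∈-perms⁺ : (xs : List A) {L : List A} → L ↭ xs → L ∈ perms xs
∈-perms⁺ []       p = here (↭-empty-inv p)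
∈-perms⁺ (x ∷ xs) p with ∈-∃++ (∈-resp-↭ (↭-sym p) (here refl))
... | as , bs , refl =
  ∈-concatMap⁺ (insertions x) (lose (∈-perms⁺ xs (drop-mid as [] p)) (∈-insertions⁺ x as bs))

perms-unique : (xs : List A) → Unique xs → Unique (perms xs)
perms-unique []       _        = [] ∷ []
perms-unique (x ∷ xs) (x∉ ∷ u) = concatMap-insertions-unique x (perms xs) (perms-unique xs u)
  λ ys∈ x∈ys → All.lookup x∉ (∈-resp-↭ (∈-perms⁻ xs ys∈) x∈ys) refl

-- Positions in lists

At : A → ℕ → List A → Set
At x _       []       = ⊥
At x zero    (z ∷ _)  = z ≡ x
At x (suc i) (_ ∷ zs) = At x i zs

At⇒∈ : {x : A} (i : ℕ) (L : List A) → At x i L → x ∈ L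
At⇒∈ zero    (z ∷ zs) refl = here refl
At⇒∈ (suc i) (z ∷ zs) a    = there (At⇒∈ i zs a)

∈-take-suc : {x : A} (i : ℕ) (L : List A) → x ∈ take (suc i) L → x ∈ take i L ⊎ At x i L
∈-take-suc zero    (z ∷ zs) (here refl) = inj₂ refl
∈-take-suc (suc i) (z ∷ zs) (here refl) = inj₁ (here refl)
∈-take-suc (suc i) (z ∷ zs) (there x∈) with ∈-take-suc i zs x∈
... | inj₁ x∈′ = inj₁ (there x∈′)
... | inj₂ a   = inj₂ a

At⇒∈-take : {x : A} (i : ℕ) (L : List A) → At x i L → x ∈ take (suc i) L
At⇒∈-take zero    (z ∷ zs) refl = here refl
At⇒∈-take (suc i) (z ∷ zs) a    = there (At⇒∈-take i zs a)

-- Lists too short for the exchange are left alone, so this is an involution, hence injective, on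
-- all lists.
swapAt : ℕ → List A → List A
swapAt zero    (a ∷ b ∷ L) = b ∷ a ∷ L
swapAt (suc i) (a ∷ L)     = a ∷ swapAt i L
swapAt _       L           = L

swapAt-involutive : (i : ℕ) (L : List A) → swapAt i (swapAt i L) ≡ L
swapAt-involutive zero    []          = refl
swapAt-involutive zero    (_ ∷ [])    = refl
swapAt-involutive zero    (_ ∷ _ ∷ _) = refl
swapAt-involutive (suc i) []          = refl
swapAt-involutive (suc i) (a ∷ L)     = cong (a ∷_) (swapAt-involutive i L)

swapAt-injective : (i : ℕ) → Injective {A = List A} _≡_ _≡_ (swapAt i)
swapAt-injective i {L} {L′} eq =
  trans (sym (swapAt-involutive i L)) (trans (cong (swapAt i) eq) (swapAt-involutive i L′))

swapAt-↭ : (i : ℕ) (L : List A) → swapAt i L ↭ L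
swapAt-↭ zero    []          = refl
swapAt-↭ zero    (_ ∷ [])    = refl
swapAt-↭ zero    (a ∷ b ∷ _) = swap b a refl
swapAt-↭ (suc i) []          = refl
swapAt-↭ (suc i) (a ∷ L)     = prep a (swapAt-↭ i L)

At-swapAt : {x : A} (i : ℕ) (L : List A) → At x (suc i) L → At x i (swapAt i L)
At-swapAt zero    (a ∷ b ∷ L) refl = refl
At-swapAt (suc i) (a ∷ L)     at   = At-swapAt i L at

-- The propositional form of `before`: as in the Boolean test, the first entry equal to `p` or `q`
-- decides.
data Before (p q : A) : List A → Set where
  here  : ∀ {zs} → q ∈ zs → Before p q (p ∷ zs)
  there : ∀ {z zs} → z ≢ p → z ≢ q → Before p q zs → Before p q (z ∷ zs)

Before-asym : {p q : A} {L : List A} → p ≢ q → Before p q L → ¬ Before q p L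
Before-asym p≢q (here _)        (here _)       = p≢q refl
Before-asym p≢q (here _)        (there _ ≢p _) = ≢p refl
Before-asym p≢q (there _ ≢q _)  (here _)       = ≢q refl
Before-asym p≢q (there _ _ b)   (there _ _ b′) = Before-asym p≢q b b′

Before-tail : {p q z : A} {zs : List A} → z ≢ p → Before p q (z ∷ zs) → Before p q zs
Before-tail z≢p (here _)      = contradiction refl z≢p
Before-tail z≢p (there _ _ b) = b

¬Before-head : {p z : A} {zs : List A} → p ≢ z → ¬ Before p z (z ∷ zs)
¬Before-head p≢z (here _)       = p≢z refl
¬Before-head p≢z (there _ ≢z _) = ≢z refl

module _ (_≟_ : DecidableEquality A) where

  At? : (x : A) (i : ℕ) → Decidable (At x i)
  At? x i       []       = no λ ()
  At? x zero    (z ∷ _)  = z ≟ x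
  At? x (suc i) (_ ∷ zs) = At? x i zs

  -- An adjacent exchange reverses only the pair it moves, and the hypothesis says that this pair is
  -- not `p`, `q`.
  Before-swapAt : {p q : A} (i : ℕ) (L : List A) → ¬ (At p i L × At q (suc i) L) →
    Before p q L → Before p q (swapAt i L)
  Before-swapAt zero    (a ∷ [])    _  b = b
  Before-swapAt zero    (a ∷ c ∷ L) ¬a (here (here refl)) = contradiction (refl , refl) ¬a
  Before-swapAt {p} {q} zero (a ∷ c ∷ L) ¬a (here (there q∈)) with c ≟ a | c ≟ q
  -- Repetitions are allowed here: if both exchanged entries are `p`, the list does not change.
  ... | yes refl | _        = here (there q∈)
  ... | no  _    | yes refl = contradiction (refl , refl) ¬a
  ... | no  c≢a  | no  c≢q  = there c≢a c≢q (here q∈)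
  Before-swapAt zero    (a ∷ c ∷ L) ¬a (there _  a≢q (here q∈))         = here (there q∈)
  Before-swapAt zero    (a ∷ c ∷ L) ¬a (there a≢p a≢q (there c≢p c≢q b)) =
    there c≢p c≢q (there a≢p a≢q b)
  Before-swapAt (suc i) (a ∷ L) ¬a (here q∈)          = here (∈-resp-↭ (↭-sym (swapAt-↭ i L)) q∈)
  Before-swapAt (suc i) (a ∷ L) ¬a (there a≢p a≢q b) = there a≢p a≢q (Before-swapAt i L ¬a b)

private variable
  m n k : ℕ

_≟E_ : DecidableEquality (Elt m n)
_≟E_ = ≡-dec FP._≟_ FP._≟_

before⇒Before : (p q : Elt m n) (L : List (Elt m n)) → T (before p q L) → Before p q L
before⇒Before p q (z ∷ zs) t with ≡-dec FP._≟_ FP._≟_ z p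
... | yes refl with find (AnyP.any⁻ (q ==_) zs t)
...   | w , w∈ , q==w with toWitness {a? = q ≟E w} q==w
...     | refl = here w∈
before⇒Before p q (z ∷ zs) t | no z≢p with ≡-dec FP._≟_ FP._≟_ z q
... | no z≢q = there z≢p z≢q (before⇒Before p q zs t)

Before⇒before : (p q : Elt m n) (L : List (Elt m n)) → Before p q L → T (before p q L)
Before⇒before p q (z ∷ zs) b with ≡-dec FP._≟_ FP._≟_ z p
Before⇒before p q (z ∷ zs) (here q∈)      | yes refl =
  AnyP.any⁺ (q ==_) (lose q∈ (fromWitness {a? = q ≟E q} refl))
Before⇒before p q (z ∷ zs) (there z≢p _ _) | yes refl = contradiction refl z≢p
Before⇒before p q (z ∷ zs) b              | no z≢p with ≡-dec FP._≟_ FP._≟_ z q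
Before⇒before p q (z ∷ zs) (here q∈)       | no z≢p | _        = contradiction refl z≢p
Before⇒before p q (z ∷ zs) (there _ z≢q _) | no z≢p | yes refl = contradiction refl z≢q
Before⇒before p q (z ∷ zs) (there _ _ b)   | no z≢p | no _     = Before⇒before p q zs b

-- Linear extensions

_⊏_ : Elt m n → Elt m n → Set
p ⊏ q = T (p <Pᵇ q)

⊏⁺ : {p q : Elt m n} → p ≤P q → p ≢ q → p ⊏ q
⊏⁺ {p = p@(a , b)} {q = q@(c , d)} (a≤c , b≤d) p≢q =
  Equivalence.from T-∧ (Equivalence.from T-∧ (fromWitness {a? = a FP.≤? c} a≤c , fromWitness {a? = b FP.≤? d} b≤d)
                       , distinct)
  where
  distinct : T (if p == q then false else true)
  distinct with ≡-dec FP._≟_ FP._≟_ p q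
  ... | yes eq = p≢q eq
  ... | no  _  = _

⊏⇒≤P : {p q : Elt m n} → p ⊏ q → p ≤P q
⊏⇒≤P {p = a , b} {q = c , d} p⊏q with Equivalence.to T-∧ (proj₁ (Equivalence.to T-∧ p⊏q))
... | a≤c , b≤d = toWitness {a? = a FP.≤? c} a≤c , toWitness {a? = b FP.≤? d} b≤d

⊏⇒≢ : {p q : Elt m n} → p ⊏ q → p ≢ q
⊏⇒≢ {p = p} {q = q} p⊏q with proj₂ (Equivalence.to (T-∧ {p ≤Pᵇ q}) p⊏q)
... | distinct with ≡-dec FP._≟_ FP._≟_ p q
...   | no p≢q = p≢q

∈-elems : (p : Elt m n) → p ∈ elems m n
∈-elems (a , b) = ∈-cartesianProduct⁺ (∈-allFin a) (∈-allFin b)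

elems-unique : (m n : ℕ) → Unique (elems m n)
elems-unique m n = UniqueP.cartesianProduct⁺ (UniqueP.allFin⁺ m) (UniqueP.allFin⁺ n)

Compatible : List (Elt m n) → Set
Compatible L = ∀ p q → p ⊏ q → Before p q L

compatible⇒Compatible : (L : List (Elt m n)) → T (compatible L) → Compatible L
compatible⇒Compatible {m} {n} L t p q p⊏q
  with p <Pᵇ q | All.lookup (AllP.all⁺ _ (elems m n) (All.lookup (AllP.all⁺ _ (elems m n) t) (∈-elems p))) (∈-elems q)
... | true | b = before⇒Before p q L b

Compatible⇒compatible : (L : List (Elt m n)) → Compatible L → T (compatible L)
Compatible⇒compatible {m} {n} L h =
  AllP.all⁻ _ (All.universal (λ p → AllP.all⁻ _ (All.universal (λ q → pair p q) (elems m n))) (elems m n))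
  where
  pair : ∀ p q → T (if p <Pᵇ q then before p q L else true)
  pair p q with p <Pᵇ q | h p q
  ... | true  | b = Before⇒before p q L (b _)
  ... | false | _ = _

∈-linExts⁻ : {L : List (Elt m n)} → L ∈ linExts m n → L ↭ elems m n × Compatible L
∈-linExts⁻ {m} {n} {L} L∈ with ∈-filter⁻ (T? ∘ compatible) {xs = perms (elems m n)} L∈
... | L∈perms , t = ∈-perms⁻ (elems m n) L∈perms , compatible⇒Compatible L t

∈-linExts⁺ : {L : List (Elt m n)} → L ↭ elems m n → Compatible L → L ∈ linExts m n
∈-linExts⁺ {m} {n} {L} p h =
  ∈-filter⁺ (T? ∘ compatible) (∈-perms⁺ (elems m n) p) (Compatible⇒compatible L h)

linExts-unique : (m n : ℕ) → Unique (linExts m n)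
linExts-unique m n = UniqueP.filter⁺ (T? ∘ compatible) (perms-unique (elems m n) (elems-unique m n))

-- Consequently the smaller of the two counts is at most half of the number of linear extensions.
numBefore-+-≤ : (x y : Elt m n) → x ≢ y → numBefore x y + numBefore y x ≤ numLinExts m n
numBefore-+-≤ {m} {n} x y x≢y = count-disjoint (T? ∘ before x y) (T? ∘ before y x) (linExts m n)
  λ {L} t t′ → Before-asym x≢y (before⇒Before x y L t) (before⇒Before y x L t′)

-- How linear extensions begin, for an atom beside a chain

-- `atom` leaves out index 0 because in the intended cases `c zero` is the minimum of the poset and
-- so lies below `x`.
record AtomBesideChain (x : Elt m n) (c : Fin k → Elt m n) : Set where
  field
    increasing : ∀ {i j} → i F.< j → c i ⊏ c j
    cover      : ∀ z → z ≡ x ⊎ x ⊏ z ⊎ ∃ λ i → z ≡ c i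
    avoids     : ∀ i → c i ≢ x
    atom       : ∀ i → 0 < toℕ i → ¬ (c i ⊏ x)

-- The list begins with an initial segment of the chain, immediately followed by `x`; what comes
-- after `x` is arbitrary. Passing to `c ∘ suc` in `step` makes the tail an instance of the same
-- notion.
data Shape (x : A) : ∀ {k} → (Fin k → A) → List A → Set where
  stop : ∀ {k} {c : Fin k → A} {R} → Shape x c (x ∷ R)
  step : ∀ {k} {c : Fin (suc k) → A} {R} → Shape x (c ∘ suc) R → Shape x c (c zero ∷ R)

shape-∈-take : {x : A} {c : Fin k → A} {R : List A} → Shape x c R → x ∈ take (suc k) R
shape-∈-take stop     = here refl
shape-∈-take (step s) = there (shape-∈-take s)

-- Only chain elements precede `x`, each at the position given by its own index. Uniqueness rules
-- out a second `x` further on.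
shape-predecessor : {x p : A} {c : Fin k → A} {R : List A} (i : ℕ) → Shape x c R → Unique R →
  At x (suc i) R → At p i R → ∃ λ j → toℕ j ≡ i × p ≡ c j
shape-predecessor i       (stop {R = R}) (x∉ ∷ _) at _    = contradiction refl (All.lookup x∉ (At⇒∈ i R at))
shape-predecessor zero    (step s) _        at refl = zero , refl , refl
shape-predecessor (suc i) (step s) (_ ∷ u)  at ap with shape-predecessor i s u at ap
... | j , refl , eq = suc j , refl , eq

module _ {x : A} where

  -- With its converse below, this turns P(x ≺ cᵢ) into a statement on the position of `x`: if `x`
  -- is not among the first i + 1 entries, these are c₀, ..., cᵢ, so cᵢ comes first.
  shape-Before⇒∈-take : {c : Fin k → A} {R : List A} → Shape x c R → (∀ i → c i ≢ x) →
    ∀ i → Before x (c i) R → x ∈ take (suc (toℕ i)) R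
  shape-Before⇒∈-take stop     c≢x i       b = here refl
  shape-Before⇒∈-take (step s) c≢x zero    b = contradiction b (¬Before-head (c≢x zero ∘ sym))
  shape-Before⇒∈-take (step s) c≢x (suc i) b =
    there (shape-Before⇒∈-take s (c≢x ∘ suc) i (Before-tail (c≢x zero) b))

  ∈-take⇒shape-Before : {c : Fin k → A} {R : List A} → Shape x c R → (∀ i → c i ≢ x) →
    (∀ {i j} → i F.< j → c i ≢ c j) → (∀ i → c i ∈ R) →
    ∀ i → x ∈ take (suc (toℕ i)) R → Before x (c i) R
  ∈-take⇒shape-Before stop c≢x c≢c c∈ i x∈ with c∈ i
  ... | here eq   = contradiction eq (c≢x i)
  ... | there ci∈ = here ci∈
  ∈-take⇒shape-Before (step s) c≢x c≢c c∈ zero    (here eq) = contradiction (sym eq) (c≢x zero)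
  ∈-take⇒shape-Before (step s) c≢x c≢c c∈ (suc i) (here eq) = contradiction (sym eq) (c≢x zero)
  ∈-take⇒shape-Before (step {c = c} {R = R} s) c≢x c≢c c∈ (suc i) (there x∈) =
    there (c≢x zero) (c≢c (s≤s z≤n))
      (∈-take⇒shape-Before s (c≢x ∘ suc) (c≢c ∘ s≤s) c∈R i x∈)
    where
    c∈R : ∀ j → c (suc j) ∈ R
    c∈R j with c∈ (suc j)
    ... | here eq = contradiction (sym eq) (c≢c (s≤s z≤n))
    ... | there e = e

-- The head of `R` has nothing of `R` below it. So it is not above `x`, nor a later chain element,
-- as `c zero` is still in `R`; it must be `x` or `c zero`. In the latter case the argument repeats
-- on the tail, which is why all hypotheses are relative to `R`.
compatible-suffix-shape : {x : Elt m n} {c : Fin k → Elt m n} (R : List (Elt m n)) → Unique R →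
  x ∈ R → (∀ i → c i ∈ R) →
  (∀ {z} → z ∈ R → z ≡ x ⊎ x ⊏ z ⊎ ∃ λ i → z ≡ c i) →
  (∀ {i j} → i F.< j → c i ⊏ c j) → (∀ i → c i ≢ x) →
  (∀ {p q} → p ∈ R → q ∈ R → p ⊏ q → Before p q R) → Shape x c R
compatible-suffix-shape (z ∷ R) (z∉ ∷ u) x∈ c∈ cover inc c≢x compat with cover (here refl)
... | inj₁ refl             = stop
... | inj₂ (inj₁ x⊏z)       = contradiction (compat x∈ (here refl) x⊏z) (¬Before-head (⊏⇒≢ x⊏z))
... | inj₂ (inj₂ (suc i , refl)) =
  contradiction (compat (c∈ zero) (here refl) (inc (s≤s z≤n))) (¬Before-head (⊏⇒≢ (inc (s≤s z≤n))))
... | inj₂ (inj₂ (zero , refl)) =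
  step (compatible-suffix-shape R u (tail x∈ (c≢x zero))
    (λ i → tail (c∈ (suc i)) (⊏⇒≢ (inc (s≤s z≤n))))
    cover′ (inc ∘ s≤s) (c≢x ∘ suc)
    λ p∈ q∈ p⊏q → Before-tail (All.lookup z∉ p∈) (compat (there p∈) (there q∈) p⊏q))
  where
  tail : ∀ {w} → w ∈ z ∷ R → z ≢ w → w ∈ R
  tail (here refl) z≢w = contradiction refl z≢w
  tail (there w∈)  _   = w∈
  cover′ : ∀ {w} → w ∈ R → _
  cover′ w∈ with cover (there w∈)
  ... | inj₁ eq                      = inj₁ eq
  ... | inj₂ (inj₁ x⊏w)              = inj₂ (inj₁ x⊏w)
  -- By uniqueness the removed `c zero` does not return, so the remaining chain indices shift down
  -- by one.
  ... | inj₂ (inj₂ (zero , refl))    = contradiction refl (All.lookup z∉ w∈)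
  ... | inj₂ (inj₂ (suc i , eq))     = inj₂ (inj₂ (i , eq))

-- A discrete intermediate value argument

-- Either 3 A 1 already lies in [N, 2N], or every step from index 1 on is at most D 1 ≤ A 1 < N/3, too short
-- to jump over that interval.
crossing : (A D : ℕ → ℕ) (N k : ℕ) → (∀ i → A (suc i) ≤ A i + D (suc i)) → (∀ i → D (suc (suc i)) ≤ D (suc i)) →
  D 1 ≤ A 1 → A 1 + A 1 ≤ N → N ≤ A (suc (suc k)) →
  ∃ λ i → i < suc (suc k) × N ≤ 3 * A i × 3 * A i ≤ 2 * N
crossing A D N k A-step D-step D₁≤A₁ 2A₁≤N N≤Aₖ with N ≤? 3 * A 1
... | yes N≤3A₁ = 1 , s≤s (s≤s z≤n) , N≤3A₁ , (begin
    3 * A 1           ≤⟨ *-monoˡ-≤ (A 1) (n≤1+n 3) ⟩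
    4 * A 1           ≡⟨ *-assoc 2 2 (A 1) ⟩
    2 * (2 * A 1)     ≡⟨ cong (λ a → 2 * (A 1 + a)) (+-identityʳ (A 1)) ⟩
    2 * (A 1 + A 1)   ≤⟨ *-monoʳ-≤ 2 2A₁≤N ⟩
    2 * N             ∎)
  where open ≤-Reasoning
... | no N≰3A₁ = search k 0 (≰⇒> N≰3A₁) (+-identityʳ k)
  where
  open ≤-Reasoning
  D≤A₁ : ∀ i → D (suc i) ≤ A 1
  D≤A₁ zero    = D₁≤A₁
  D≤A₁ (suc i) = ≤-trans (D-step i) (D≤A₁ i)
  next : ∀ i → 3 * A (suc i) ≤ 3 * A i + 3 * A 1
  next i = begin
    3 * A (suc i)              ≤⟨ *-monoʳ-≤ 3 (≤-trans (A-step i) (+-monoʳ-≤ (A i) (D≤A₁ i))) ⟩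
    3 * (A i + A 1)            ≡⟨ *-distribˡ-+ 3 (A i) (A 1) ⟩
    3 * A i + 3 * A 1          ∎
  next< : ∀ i → 3 * A i < N → 3 * A (suc i) < 2 * N
  next< i 3Aᵢ<N = begin-strict
    3 * A (suc i)      ≤⟨ next i ⟩
    3 * A i + 3 * A 1  <⟨ +-mono-< 3Aᵢ<N (≰⇒> N≰3A₁) ⟩
    N + N              ≡⟨ cong (N +_) (sym (+-identityʳ N)) ⟩
    2 * N              ∎
  search : ∀ d i → 3 * A (suc i) < N → d + i ≡ k → ∃ λ i → i < suc (suc k) × N ≤ 3 * A i × 3 * A i ≤ 2 * N
  -- Here `i` is `k`: the next value, tripled, stays below 2N by `next<`, yet is at least 3N by
  -- `N≤Aₖ`.
  search zero    i lt refl = contradiction (begin-strict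
    2 * N ≤⟨ *-monoˡ-≤ N (n≤1+n 2) ⟩
    3 * N ≤⟨ *-monoʳ-≤ 3 N≤Aₖ ⟩
    3 * A (suc (suc i)) <⟨ next< (suc i) lt ⟩
    2 * N ∎) (<-irrefl refl)
  search (suc d) i lt refl with N ≤? 3 * A (suc (suc i))
  ... | yes N≤ = suc (suc i) , s≤s (s≤s (s≤s (m≤n+m i d))) , N≤ , <⇒≤ (next< (suc i) lt)
  ... | no  N≰ = search d (suc i) (≰⇒> N≰) (+-suc d i)

-- Counting linear extensions by the position of the atom

module _ {x : Elt m n} {c : Fin k → Elt m n} (atomChain : AtomBesideChain x c) where
  open AtomBesideChain atomChain

  private
    open DecMembership (_≟E_ {m} {n}) using (_∈?_)

    module _ {L : List (Elt m n)} (L∈ : L ∈ linExts m n) where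

      unique : Unique L
      unique = Unique-resp-↭ (↭-sym (proj₁ (∈-linExts⁻ L∈))) (elems-unique m n)

      ∈-linExt : ∀ z → z ∈ L
      ∈-linExt z = ∈-resp-↭ (↭-sym (proj₁ (∈-linExts⁻ L∈))) (∈-elems z)

      shape : Shape x c L
      shape = compatible-suffix-shape L unique (∈-linExt x) (∈-linExt ∘ c) (λ {z} _ → cover z)
        increasing avoids (λ {p} {q} _ _ → proj₂ (∈-linExts⁻ L∈) p q)

      -- The predecessor of `x` is the chain element of index i + 1. This index is positive, so by
      -- `atom` that element is not below `x` and the two may be exchanged. At position 1 the
      -- predecessor would be `c zero`, to which `atom` does not apply.
      swapAt-linExt : ∀ i → At x (suc (suc i)) L →
        swapAt (suc i) L ∈ linExts m n × At x (suc i) (swapAt (suc i) L)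
      swapAt-linExt i at =
        ∈-linExts⁺ (↭-trans (swapAt-↭ (suc i) L) (proj₁ (∈-linExts⁻ L∈))) compat , At-swapAt (suc i) L at
        where
        At-functional : ∀ {q} j (R : List (Elt m n)) → At x j R → At q j R → q ≡ x
        At-functional zero    (_ ∷ _) refl refl = refl
        At-functional (suc j) (_ ∷ R) a    b    = At-functional j R a b
        compat : Compatible (swapAt (suc i) L)
        compat p q p⊏q = Before-swapAt _≟E_ (suc i) L excluded (proj₂ (∈-linExts⁻ L∈) p q p⊏q)
          where
          excluded : ¬ (At p (suc i) L × At q (suc (suc i)) L)
          excluded (ap , aq) with At-functional (suc (suc i)) L at aq
          ... | refl with shape-predecessor (suc i) shape unique at ap
          ...   | j , j≡ , refl = atom j (subst (0 <_) (sym j≡) (s≤s z≤n)) p⊏q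

  -- Positions start at 0. `numWithin` is the cumulative count of `numAt`; taking `suc i` entries
  -- makes its value at `toℕ i` agree with `numBefore x (c i)`, and it also makes sense at `k`, past
  -- the end of the chain.
  numWithin numAt : ℕ → ℕ
  numWithin i = count (λ L → x ∈? take (suc i) L) (linExts m n)
  numAt     i = count (At? _≟E_ x i) (linExts m n)

  numBefore≡numWithin : ∀ i → numBefore x (c i) ≡ numWithin (toℕ i)
  numBefore≡numWithin i = ≤-antisym
    (count-mono (T? ∘ before x (c i)) (λ L → x ∈? take (suc (toℕ i)) L) (linExts m n)
      λ {L} L∈ t → shape-Before⇒∈-take (shape L∈) avoids i (before⇒Before x (c i) L t))
    (count-mono (λ L → x ∈? take (suc (toℕ i)) L) (T? ∘ before x (c i)) (linExts m n)
      λ {L} L∈ x∈ → Before⇒before x (c i) L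
        (∈-take⇒shape-Before (shape L∈) avoids (⊏⇒≢ ∘ increasing) (∈-linExt L∈ ∘ c) i x∈))

  numWithin-suc : ∀ i → numWithin (suc i) ≤ numWithin i + numAt (suc i)
  numWithin-suc i = count-≤-+ _ _ (At? _≟E_ x (suc i)) (linExts m n) λ {L} _ → ∈-take-suc (suc i) L

  numAt≤numWithin : ∀ i → numAt i ≤ numWithin i
  numAt≤numWithin i = count-mono _ _ (linExts m n) λ {L} _ → At⇒∈-take i L

  numAt-decreasing : ∀ i → numAt (suc (suc i)) ≤ numAt (suc i)
  numAt-decreasing i = count-injection _ _ (linExts-unique m n) (swapAt-injective (suc i)) λ L∈ → swapAt-linExt L∈ i

  -- At most the `k` chain elements precede `x`. This is the upper end required by `crossing`.
  numLinExts≤numWithin : numLinExts m n ≤ numWithin k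
  numLinExts≤numWithin = ≤-reflexive (sym (cong length (filter-all _ (All.tabulate λ L∈ → shape-∈-take (shape L∈)))))

-- The count reaches its full value one step past the last chain index, while `crossing` stops
-- strictly before that, so its index names a chain element.
atomBesideChain-balanced : {x : Elt m n} {c : Fin (suc (suc k)) → Elt m n} → AtomBesideChain x c →
  numBefore x (c (suc zero)) + numBefore x (c (suc zero)) ≤ numLinExts m n →
  Σ (Elt m n) λ x → Σ (Elt m n) λ y → (x ≢ y) × Balanced x y
atomBesideChain-balanced {m} {n} {k} {x} {c} ac 2B≤N
  with crossing (numWithin ac) (numAt ac) (numLinExts m n) k (numWithin-suc ac) (numAt-decreasing ac)
         (numAt≤numWithin ac 1) (subst (λ a → a + a ≤ numLinExts m n) (numBefore≡numWithin ac (suc zero)) 2B≤N)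
         (numLinExts≤numWithin ac)
... | i , i<k , lower , upper =
  x , c j , AtomBesideChain.avoids ac j ∘ sym ,
  subst (λ b → numLinExts m n ≤ 3 * b) eq lower , subst (λ b → 3 * b ≤ 2 * numLinExts m n) eq upper
  where
  j = fromℕ< i<k
  eq : numWithin ac i ≡ numBefore x (c j)
  eq = trans (cong (numWithin ac) (sym (FP.toℕ-fromℕ< i<k))) (sym (numBefore≡numWithin ac j))

-- The two atoms of a product of chains

firstRow : AtomBesideChain {suc (suc m)} {suc n} (suc zero , zero) (zero ,_)
firstRow {m} {n} = record
  { increasing = λ {i} {j} i<j → ⊏⁺ {suc (suc m)} {suc n} {zero , i} {zero , j} (z≤n , <⇒≤ i<j) λ { refl → <-irrefl refl i<j }
  ; cover      = cover
  ; avoids     = λ _ ()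
  ; atom       = λ { (suc i) _ ci⊏x → case proj₂ (⊏⇒≤P {suc (suc m)} {suc n} {zero , suc i} {suc zero , zero} ci⊏x) of λ () }
  }
  where
  cover : (z : Elt (suc (suc m)) (suc n)) → _
  cover (zero  , b) = inj₂ (inj₂ (b , refl))
  -- Outside the first row the first coordinate is at least 1, so the element is (1,0) or lies above
  -- it.
  cover (suc a , b) with (suc a , b) ≟E (suc zero , zero)
  ... | yes eq = inj₁ eq
  ... | no  z≢ = inj₂ (inj₁ (⊏⁺ (s≤s z≤n , z≤n) (z≢ ∘ sym)))

firstColumn : AtomBesideChain {suc m} {suc (suc n)} (zero , suc zero) (_, zero)
firstColumn {m} {n} = record
  { increasing = λ {i} {j} i<j → ⊏⁺ {suc m} {suc (suc n)} {i , zero} {j , zero} (<⇒≤ i<j , z≤n) λ { refl → <-irrefl refl i<j }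
  ; cover      = cover
  ; avoids     = λ _ ()
  ; atom       = λ { (suc i) _ ci⊏x → case proj₁ (⊏⇒≤P {suc m} {suc (suc n)} {suc i , zero} {zero , suc zero} ci⊏x) of λ () }
  }
  where
  cover : (z : Elt (suc m) (suc (suc n))) → _
  cover (a , zero)  = inj₂ (inj₂ (a , refl))
  cover (a , suc b) with (a , suc b) ≟E (zero , suc zero)
  ... | yes eq = inj₁ eq
  ... | no  z≢ = inj₂ (inj₁ (⊏⁺ (z≤n , s≤s z≤n) (z≢ ∘ sym)))

theorem3p8 : (m n : ℕ) → 2 ≤ m → 2 ≤ n →
    Σ (Elt m n) λ x → Σ (Elt m n) λ y → (x ≢ y) × Balanced x y
theorem3p8 (suc (suc m)) (suc (suc n)) (s≤s (s≤s _)) (s≤s (s≤s _)) =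
  -- `y` is the element of index 1 in the first row, and `x` the one in the first column. Whichever
  -- of the two counts is smaller, its double is at most their sum, which supplies the bound for the
  -- corresponding atom.
  [ (λ le → atomBesideChain-balanced firstRow (≤-trans (+-monoʳ-≤ (numBefore x y) le) (numBefore-+-≤ x y λ ())))
  , (λ le → atomBesideChain-balanced firstColumn (≤-trans (+-monoʳ-≤ (numBefore y x) le) (numBefore-+-≤ y x λ ())))
  ]′ (≤-total (numBefore x y) (numBefore y x))
  where
  x y : Elt (suc (suc m)) (suc (suc n))
  x = suc zero , zero
  y = zero , suc zero
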